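{- For every integer $n \geq 4$, the graph $G_n$ has chromatic number $n-2$ and is edge-critical, i.e., $\chi(G_n - e) < \chi(G_n)$ for every edge $e$ of $G_n$.
   Context: Let $[n]=\{1,\dots,n\}$. A $2$-subset $\{a,b\}$ of $[n]$ with $a<b$ is called stable if $b \neq a+1$ and $\{a,b\}\neq\{1,n\}$; it is written $ab$. For $n\ge 4$, the graph $G_n$ has as vertex set all stable $2$-subsets of $[n]$. Two vertices $ab$ ($a<b$) and $cd$ ($c<d$) with $a<c$ are adjacent in $G_n$ if and only if $\{a,b\}\cap\{c,d\}=\emptyset$ and one of the following holds: $a<c<b<d$ (a crossing pair), or $1<a<c<d<b$ (a transverse pair). $\chi$ denotes chromatic number. -}

module Defs where

open import Data.Nat using (ℕ; suc; _≤_; _<_)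
open import Data.Nat.Properties using (<-irrefl)
open import Data.Fin using (Fin)
open import Data.Product using (Σ; _×_; _,_; proj₁; ∃-syntax)
open import Data.Sum using (_⊎_; inj₁; inj₂; swap; [_,_])
open import Relation.Nullary using (¬_)
open import Relation.Binary.PropositionalEquality using (_≡_; _≢_; refl)

record Graph : Set₁ where
  field
    Vertex   : Set
    _~_      : Vertex → Vertex → Set
    ~-sym    : ∀ {x y} → x ~ y → y ~ x
    ~-irrefl : ∀ {x} → ¬ (x ~ x)

Colourable : Graph → ℕ → Set
Colourable G k = Σ (Vertex → Fin k) λ c → ∀ {x y} → x ~ y → c x ≢ c y
  where open Graph G

-- χ as a functional relation: "k is the least number of colours".
χ[_]≡_ : Graph → ℕ → Set
χ[ G ]≡ k = Colourable G k × (∀ m → Colourable G m → k ≤ m)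

deleteEdge : (G : Graph) → Graph.Vertex G → Graph.Vertex G → Graph
deleteEdge G u v = record
  { Vertex   = Vertex
  ; _~_      = λ x y → x ~ y × ¬ (x ≡ u × y ≡ v ⊎ x ≡ v × y ≡ u)
  ; ~-sym    = λ { (e , ne) → ~-sym e , λ
                   { (inj₁ (p , q)) → ne (inj₂ (q , p))
                   ; (inj₂ (p , q)) → ne (inj₁ (q , p)) } }
  ; ~-irrefl = λ e → ~-irrefl (proj₁ e)
  }
  where open Graph G

EdgeCritical : Graph → Set
EdgeCritical G = ∀ u v → u ~ v →
  ∃[ j ] ∃[ k ] (χ[ deleteEdge G u v ]≡ j) × (χ[ G ]≡ k) × j < k
  where open Graph G

-- A stable 2-subset {lo , hi} of [n] = {1,…,n}.  The proofs are irrelevant, so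
-- two vertices are equal exactly when their endpoints are.
record Stable (n : ℕ) : Set where
  constructor stable
  field
    lo hi     : ℕ
    .1≤lo     : 1 ≤ lo
    .lo<hi    : lo < hi
    .hi≤n     : hi ≤ n
    .hi≢1+lo  : hi ≢ suc lo
    .not-1n   : ¬ (lo ≡ 1 × hi ≡ n)

module _ {n : ℕ} where
  open Stable

  Disjoint : Stable n → Stable n → Set
  Disjoint x y = lo x ≢ lo y × lo x ≢ hi y × hi x ≢ lo y × hi x ≢ hi y

  Crossing : Stable n → Stable n → Set
  Crossing x y = lo x < lo y × lo y < hi x × hi x < hi y

  Transverse : Stable n → Stable n → Set
  Transverse x y = 1 < lo x × lo x < lo y × lo y < hi y × hi y < hi x

  -- Adjacency of ab and cd in the case a < c.
  OrderedAdj : Stable n → Stable n → Set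
  OrderedAdj x y = lo x < lo y × Disjoint x y × (Crossing x y ⊎ Transverse x y)

G : ℕ → Graph
G n = record
  { Vertex   = Stable n
  ; _~_      = λ x y → OrderedAdj x y ⊎ OrderedAdj y x
  ; ~-sym    = swap
  ; ~-irrefl = [ (λ e → <-irrefl refl (proj₁ e)) , (λ e → <-irrefl refl (proj₁ e)) ]
  }

{-# OPTIONS --safe #-}
module Submission where

-- Lower bound: G (n+1) is a Mycielski-like extension of G n.  The pair 1n is adjacent
-- only to the pairs t(n+1), and each vertex of G n is dominated by one of these, so a
-- (k+1)-colouring of G (n+1) yields a k-colouring of G n.  Colouring by the smaller
-- point attains the bound.
--
-- Criticality: let a < b < c < d be the points of the deleted edge.  Points outside a
-- core containing a, b, c, d serve as colours for the stars around them.  If the edge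
-- is ac-bd with a = 1 or c = b + 1, all pairs inside the core {a,b,c,d} get one
-- colour.  Otherwise the core is {1,a,d} ∪ [b,c]; one class consists of the deleted
-- edge and a third pair, the others are essentially the sets of pairs with a given
-- smaller point, and the pairs starting at 1, c - 1 or c fit into these.  Either way
-- the colours used number three fewer than the points.

open import Defs
open import Data.Nat using (ℕ; zero; suc; pred; _+_; _∸_; _≤_; _<_; z≤n; s≤s; z<s; s≤s⁻¹; _≟_; _≤?_; _<?_)
open import Data.Nat.Properties hiding (suc-injective)
open import Data.Fin using (Fin; fromℕ<; punchOut) renaming (zero to fzero; suc to fsuc; _≟_ to _≟ᶠ_)
open import Data.Fin.Properties using (punchOut-injective; suc-injective; fromℕ<-injective)
open import Data.Product using (_×_; _,_; proj₁; proj₂; ∃-syntax)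
open import Data.Sum using (_⊎_; inj₁; inj₂; swap)
open import Data.Empty using (⊥; ⊥-elim)
open import Function using (_∘_; case_of_)
open import Relation.Nullary using (¬_; Dec; yes; no; contradiction; recompute)
open import Relation.Nullary.Decidable using (_×-dec_; _⊎-dec_; map′)
open import Relation.Binary.Definitions using (tri<; tri≈; tri>)
open import Relation.Binary.PropositionalEquality using (_≡_; _≢_; refl; sym; trans; cong; subst; subst₂; ≢-sym)

open Stable using (lo; hi)

-- Stable pairs

module _ {n : ℕ} where

  -- The proof fields are irrelevant, so each inequality is recovered by deciding it afresh.
  1≤lo : (v : Stable n) → 1 ≤ lo v
  1≤lo (stable l _ p _ _ _ _) = recompute (1 ≤? l) p

  lo<hi : (v : Stable n) → lo v < hi v
  lo<hi (stable l h _ p _ _ _) = recompute (l <? h) p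

  hi≤n : (v : Stable n) → hi v ≤ n
  hi≤n (stable _ h _ _ p _ _) = recompute (h ≤? n) p

  2+lo≤hi : (v : Stable n) → 2 + lo v ≤ hi v
  2+lo≤hi (stable l h _ p _ q _) = recompute (2 + l ≤? h) (≤∧≢⇒< p (≢-sym q))

  lo≡1⇒hi<n : (v : Stable n) → lo v ≡ 1 → hi v < n
  lo≡1⇒hi<n (stable l h _ _ p _ q) l≡1 = recompute (h <? n) (≤∧≢⇒< p (λ h≡n → q (l≡1 , h≡n)))

  stable-ext : {x y : Stable n} → lo x ≡ lo y → hi x ≡ hi y → x ≡ y
  stable-ext refl refl = refl

  _≟ˢ_ : (x y : Stable n) → Dec (x ≡ y)
  x ≟ˢ y = map′ (λ (p , q) → stable-ext p q) (λ { refl → refl , refl }) (lo x ≟ lo y ×-dec hi x ≟ hi y)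

-- The lower bound

embed : ∀ {n} → Stable n → Stable (suc n)
embed (stable l h p q r s _) = stable l h p q (m≤n⇒m≤1+n r) s (λ { (_ , refl) → 1+n≰n r })

module _ {n : ℕ} where

  open Graph (G n) using () renaming (_~_ to _~ₙ_)
  open Graph (G (suc n)) using (_~_)

  apex : 3 ≤ n → Stable (suc n)
  apex 3≤n = stable 1 n ≤-refl (≤-trans (s≤s (s≤s z≤n)) 3≤n) (n≤1+n n)
    (λ { refl → 1+n≰n 3≤n }) (λ (_ , eq) → 1+n≢n (sym eq))

  spoke : ∀ t → 1 < t → t < n → Stable (suc n)
  spoke t 1<t t<n = stable t (suc n) (<⇒≤ 1<t) (m≤n⇒m≤1+n t<n) ≤-refl
    (λ eq → <⇒≢ t<n (sym (cong pred eq))) (λ (eq , _) → <⇒≢ 1<t (sym eq))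

  apex~spoke : ∀ 3≤n {t} 1<t t<n → apex 3≤n ~ spoke t 1<t t<n
  apex~spoke 3≤n 1<t t<n = inj₁
    ( 1<t
    , (<⇒≢ 1<t , <⇒≢ (≤-trans (s≤s (s≤s z≤n)) (m≤n⇒m≤1+n 3≤n)) , >⇒≢ t<n , <⇒≢ (n<1+n n))
    , inj₁ (1<t , t<n , n<1+n n))

  -- The pairs cross when `lo w` lies below `t`; otherwise `w` nests inside the spoke, which is an
  -- edge because 1 < t.
  spoke~ : ∀ {t} 1<t t<n (w : Stable n) → lo w ≢ t → t < hi w → spoke t 1<t t<n ~ embed w
  spoke~ {t} 1<t t<n w lo≢t t<hi with <-cmp (lo w) t
  ... | tri< lo<t _ _ = inj₂
    (lo<t , (lo≢t , <⇒≢ (<-trans lo<t (m≤n⇒m≤1+n t<n)) , >⇒≢ t<hi , <⇒≢ (s≤s (hi≤n w)))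
    , inj₁ (lo<t , t<hi , s≤s (hi≤n w)))
  ... | tri≈ _ lo≡t _ = contradiction lo≡t lo≢t
  ... | tri> _ _ t<lo = inj₁
    (t<lo , (≢-sym lo≢t , <⇒≢ t<hi , >⇒≢ (<-trans (lo<hi w) (s≤s (hi≤n w))) , >⇒≢ (s≤s (hi≤n w)))
    , inj₂ (1<t , t<lo , lo<hi w , s≤s (hi≤n w)))

  -- A vertex v of G n is dominated by the spoke at lo v, or at hi v when lo v = 1.
  twin : (v : Stable n) → ∃[ t ] ∃[ 1<t ] ∃[ t<n ] (∀ w → v ~ₙ w → spoke t 1<t t<n ~ embed w)
  twin v with lo v ≟ 1
  ... | no lo≢1 = lo v , 1<lo , lo<n , dominates
    where
    1<lo = ≤∧≢⇒< (1≤lo v) (≢-sym lo≢1)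
    lo<n = ≤-trans (lo<hi v) (hi≤n v)
    dominates : ∀ w → v ~ₙ w → spoke (lo v) 1<lo lo<n ~ embed w
    dominates w (inj₁ (v<w , _)) = spoke~ 1<lo lo<n w (>⇒≢ v<w) (<-trans v<w (lo<hi w))
    dominates w (inj₂ (w<v , _ , inj₁ (_ , lo<hi′ , _))) = spoke~ 1<lo lo<n w (<⇒≢ w<v) lo<hi′
    dominates w (inj₂ (w<v , _ , inj₂ (_ , _ , l<h , h<h))) = spoke~ 1<lo lo<n w (<⇒≢ w<v) (<-trans l<h h<h)
  -- A pair starting at 1 has no transverse neighbours and none starting further left, so every
  -- neighbour crosses it and ends beyond `hi v`.
  ... | yes lo≡1 = hi v , 1<hi , hi<n , dominates
    where
    1<hi = subst (_< hi v) lo≡1 (lo<hi v)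
    hi<n = lo≡1⇒hi<n v lo≡1
    dominates : ∀ w → v ~ₙ w → spoke (hi v) 1<hi hi<n ~ embed w
    dominates w (inj₁ (_ , (_ , _ , hi≢lo , _) , inj₁ (_ , _ , h<h))) = spoke~ 1<hi hi<n w (≢-sym hi≢lo) h<h
    dominates w (inj₁ (_ , _ , inj₂ (1<lo , _))) = contradiction lo≡1 (>⇒≢ 1<lo)
    dominates w (inj₂ (w<v , _)) = contradiction (subst (lo w <_) lo≡1 w<v) (≤⇒≯ (1≤lo w))

  -- Mycielski's recolouring: no spoke has the colour of the apex, so the vertices
  -- with that colour may take the colours of their twins.
  colourable-pred : 3 ≤ n → ∀ {k} → Colourable (G (suc n)) (suc k) → Colourable (G n) k
  colourable-pred 3≤n {k} (c , proper) = (λ v → punchOut (proj₁ (proj₂ (rep v)))) , λ {x} {y} → proper′ x y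
    where
    z = apex 3≤n

    Rep : Stable n → Stable (suc n) → Set
    Rep v r = r ≡ embed v ⊎ (c z ≡ c (embed v) × (∀ w → v ~ₙ w → r ~ embed w))

    rep : ∀ v → ∃[ r ] (c z ≢ c r) × Rep v r
    rep v = case (c z ≟ᶠ c (embed v)) of λ where
      (no c≢)  → embed v , c≢ , inj₁ refl
      (yes c≡) → let (t , 1<t , t<n , dom) = twin v in
        spoke t 1<t t<n , proper (apex~spoke 3≤n 1<t t<n) , inj₂ (c≡ , dom)

    rep-proper : ∀ {v w r s} → v ~ₙ w → Rep v r → Rep w s → c r ≢ c s
    rep-proper v~w (inj₁ refl) (inj₁ refl) = proper v~w
    rep-proper {w = w} v~w (inj₂ (_ , dom)) (inj₁ refl) = proper (dom w v~w)
    rep-proper {v = v} v~w (inj₁ refl) (inj₂ (_ , dom)) = ≢-sym (proper (dom v (swap v~w)))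
    -- Vertices with the colour of the apex are not adjacent, so at most one end of an edge is
    -- replaced.
    rep-proper v~w (inj₂ (p , _)) (inj₂ (q , _)) = λ _ → proper v~w (trans (sym p) q)

    proper′ : ∀ x y → x ~ₙ y → punchOut (proj₁ (proj₂ (rep x))) ≢ punchOut (proj₁ (proj₂ (rep y)))
    proper′ x y x~y eq = rep-proper {x} {y} x~y (proj₂ (proj₂ (rep x))) (proj₂ (proj₂ (rep y)))
      (punchOut-injective (proj₁ (proj₂ (rep x))) (proj₁ (proj₂ (rep y))) eq)

-- Each further point costs a colour by `colourable-pred`; the induction ends at `G 4`, which has an
-- edge.
χ-lower-bound : ∀ m k → Colourable (G (4 + m)) k → 2 + m ≤ k
χ-lower-bound m zero (c , _) with c (apex (s≤s (s≤s (s≤s z≤n))))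
... | ()
χ-lower-bound (suc m) (suc k) col = s≤s (χ-lower-bound m k (colourable-pred (s≤s (s≤s (s≤s z≤n))) col))
χ-lower-bound zero (suc (suc k)) _ = s≤s (s≤s z≤n)
χ-lower-bound zero (suc zero) (c , proper) =
  -- The edge joins 13 and 24: apex and spoke for n = 3.
  contradiction (Fin1-unique _ _) (proper {apex ≤-refl} {spoke 2 ≤-refl ≤-refl} (apex~spoke ≤-refl {2} ≤-refl ≤-refl))
  where
  Fin1-unique : (i j : Fin 1) → i ≡ j
  Fin1-unique fzero fzero = refl

-- Colourings by natural numbers

fromℕ-colouring : ∀ {H : Graph} {m} (c : Graph.Vertex H → ℕ) → (∀ v → c v < m) →
  (∀ {x y} → Graph._~_ H x y → c x ≢ c y) → Colourable H m
fromℕ-colouring c c<m proper =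
  (λ v → fromℕ< (c<m v)) , λ {x} {y} x~y eq → proper x~y (fromℕ<-injective (c x) (c y) (c<m x) (c<m y) eq)

-- Adjacent pairs have different smaller points, and the gap of two inside a stable pair keeps these
-- in 1, ..., m.
colourable-by-lo : ∀ m → Colourable (G (2 + m)) m
colourable-by-lo m = fromℕ-colouring {G (2 + m)} (pred ∘ lo) bound λ {x} {y} → proper {x} {y}
  where
  open Graph (G (2 + m)) using (_~_)
  pred< : ∀ {l} → 1 ≤ l → 2 + l ≤ 2 + m → pred l < m
  pred< (s≤s z≤n) (s≤s (s≤s p)) = p
  bound : ∀ v → pred (lo v) < m
  bound v = pred< (1≤lo v) (≤-trans (2+lo≤hi v) (hi≤n v))
  pred-cancel : ∀ {k l} → 1 ≤ k → 1 ≤ l → pred k ≡ pred l → k ≡ l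
  pred-cancel (s≤s z≤n) (s≤s z≤n) = cong suc
  proper : ∀ {x y} → x ~ y → pred (lo x) ≢ pred (lo y)
  proper {x} {y} (inj₁ (l< , _)) eq = <⇒≢ l< (pred-cancel (1≤lo x) (1≤lo y) eq)
  proper {x} {y} (inj₂ (l< , _)) eq = >⇒≢ l< (pred-cancel (1≤lo x) (1≤lo y) eq)

-- Closes the gap left by an unattained value `p`: larger numbers drop by one, smaller ones stay.
-- The value at `p` itself is a default.
skip : ℕ → ℕ → ℕ
skip zero    k       = pred k
skip (suc p) zero    = zero
skip (suc p) (suc k) = suc (skip p k)

skip-injective : ∀ p {k l} → k ≢ p → l ≢ p → skip p k ≡ skip p l → k ≡ l
skip-injective zero    {zero}          k≢ l≢ eq = contradiction refl k≢
skip-injective zero    {suc k} {zero}  k≢ l≢ eq = contradiction refl l≢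
skip-injective zero    {suc k} {suc l} k≢ l≢ eq = cong suc eq
skip-injective (suc p) {zero}  {zero}  k≢ l≢ eq = refl
skip-injective (suc p) {suc k} {suc l} k≢ l≢ eq =
  cong suc (skip-injective p (k≢ ∘ cong suc) (l≢ ∘ cong suc) (cong pred eq))

skip-< : ∀ {p k m} → p ≤ m → k ≢ p → k < suc m → skip p k < m
skip-< {zero}  {zero}  _ k≢ _ = contradiction refl k≢
skip-< {zero}  {suc k} _ _ k< = s≤s⁻¹ k<
skip-< {suc p} {zero}  (s≤s _) _ _ = z<s
skip-< {suc p} {suc k} (s≤s p≤) k≢ k< = s≤s (skip-< p≤ (k≢ ∘ cong suc) (s≤s⁻¹ k<))

-- Values below `p` come only from themselves, so a smaller gap survives the closing of a larger
-- one.
skip-≢ : ∀ {p q k} → q < p → k ≢ q → skip p k ≢ q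
skip-≢ {suc p} {zero}  {zero}  _ k≢ = k≢
skip-≢ {suc p} {zero}  {suc k} _ _ = λ ()
skip-≢ {suc p} {suc q} {zero}  _ _ = λ ()
skip-≢ {suc p} {suc q} {suc k} (s≤s q<p) k≢ = skip-≢ q<p (k≢ ∘ cong suc) ∘ cong pred

module _ {H : Graph} where
  open Graph H

  -- The colours lie in 0, ..., 3 + m and miss 0, p, q and r; closing these four gaps from the top
  -- down leaves m colours.
  colourable-avoiding : ∀ {m p q r} → 1 ≤ p → p < q → q < r → r ≤ 3 + m → (c : Vertex → ℕ) →
    (∀ v → 1 ≤ c v × c v ≤ 3 + m) → (∀ v → c v ≢ p × c v ≢ q × c v ≢ r) →
    (∀ {x y} → x ~ y → c x ≢ c y) → Colourable H m
  colourable-avoiding {m} {p} {q} {r} 1≤p p<q q<r r≤ c bounds avoids proper =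
    fromℕ-colouring {H = H} (skip 0 ∘ c₁) (λ v → skip-< z≤n (c₁≢0 v) (c₁< v))
      λ {x} {y} x~y eq → proper x~y
        (skip-injective r (c≢r x) (c≢r y)
        (skip-injective q (c₃≢q x) (c₃≢q y)
        (skip-injective p (c₂≢p x) (c₂≢p y)
        (skip-injective 0 (c₁≢0 x) (c₁≢0 y) eq))))
    where
    c₃ = skip r ∘ c
    c₂ = skip q ∘ c₃
    c₁ = skip p ∘ c₂
    0<q = <-trans 1≤p p<q
    c≢r : ∀ v → c v ≢ r
    c≢r v = proj₂ (proj₂ (avoids v))
    c₃≢q : ∀ v → c₃ v ≢ q
    c₃≢q v = skip-≢ q<r (proj₁ (proj₂ (avoids v)))
    c₂≢p : ∀ v → c₂ v ≢ p
    c₂≢p v = skip-≢ p<q (skip-≢ (<-trans p<q q<r) (proj₁ (avoids v)))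
    c₁≢0 : ∀ v → c₁ v ≢ 0
    c₁≢0 v = skip-≢ 1≤p (skip-≢ 0<q (skip-≢ (<-trans 0<q q<r) (>⇒≢ (proj₁ (bounds v)))))
    q≤ : q ≤ 2 + m
    q≤ = s≤s⁻¹ (≤-trans q<r r≤)
    c₁< : ∀ v → c₁ v < 1 + m
    c₁< v = skip-< (s≤s⁻¹ (≤-trans p<q q≤)) (c₂≢p v)
            (skip-< q≤ (c₃≢q v)
            (skip-< r≤ (c≢r v) (s≤s (proj₂ (bounds v)))))

-- Edge deletion

-- The pairs inside Core are distributed among the classes; every other pair gets
-- as colour one of its points outside Core.  The three points of Core that label
-- no class bring the number of colours down to n - 3.
record CoreColouring {n} (u v : Stable n) : Set₁ where
  field
    Core        : ℕ → Set
    core?       : ∀ k → Dec (Core k)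
    core-bounds : ∀ {k} → Core k → 1 ≤ k × k ≤ n
    Class       : ℕ → Stable n → Set
    classify    : ∀ w → Core (lo w) → Core (hi w) → ∃[ k ] Class k w
    class-core  : ∀ {k w} → Class k w → Core k
    {p q r}     : ℕ
    core-p      : Core p
    core-q      : Core q
    core-r      : Core r
    p<q         : p < q
    q<r         : q < r
    unused      : ∀ {k w} → Class k w → k ≢ p × k ≢ q × k ≢ r
    only-edge   : ∀ {k x y} → Class k x → Class k y → OrderedAdj x y →
                  (lo x ≡ lo u × hi x ≡ hi u) × (lo y ≡ lo v × hi y ≡ hi v)

-- Pairs coloured by the same outside point meet there, class labels lie in `Core` and so differ
-- from outside points, and a class contains no edge but the deleted one.
colourable-deleteEdge : ∀ {m} {u v : Stable (3 + m)} → CoreColouring u v →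
  Colourable (deleteEdge (G (3 + m)) u v) m
colourable-deleteEdge {m} {u} {v} C = colourable-avoiding {deleteEdge (G (3 + m)) u v}
  (proj₁ (core-bounds core-p)) p<q q<r (proj₂ (core-bounds core-r))
  (proj₁ ∘ colour) (λ w → bounds w (proj₂ (colour w))) (λ w → avoids w (proj₂ (colour w)))
  λ {x} {y} x~y eq → proper x~y (proj₂ (colour x)) (subst (λ k → Colour k y) (sym eq) (proj₂ (colour y)))
  where
  open CoreColouring C
  n = 3 + m
  open Graph (deleteEdge (G n) u v) using (_~_)

  -- Records why a pair has its colour, so that properness is checked by cases on the reasons.
  Colour : ℕ → Stable n → Set
  Colour k w = (¬ Core k × (lo w ≡ k ⊎ hi w ≡ k)) ⊎ Class k w

  colour : ∀ w → ∃[ k ] Colour k w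
  colour w with core? (lo w) | core? (hi w)
  ... | no ¬p | _     = lo w , inj₁ (¬p , inj₁ refl)
  ... | yes _ | no ¬p = hi w , inj₁ (¬p , inj₂ refl)
  ... | yes p | yes q = let (k , cl) = classify w p q in k , inj₂ cl

  bounds : ∀ w {k} → Colour k w → 1 ≤ k × k ≤ n
  bounds w (inj₁ (_ , inj₁ refl)) = 1≤lo w , ≤-trans (<⇒≤ (lo<hi w)) (hi≤n w)
  bounds w (inj₁ (_ , inj₂ refl)) = ≤-trans (1≤lo w) (<⇒≤ (lo<hi w)) , hi≤n w
  bounds w (inj₂ cl) = core-bounds (class-core cl)

  avoids : ∀ w {k} → Colour k w → k ≢ p × k ≢ q × k ≢ r
  avoids w (inj₁ (¬k , _)) = (λ { refl → ¬k core-p }) , (λ { refl → ¬k core-q }) , (λ { refl → ¬k core-r })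
  avoids w (inj₂ cl) = unused cl

  meet : ∀ {k} {x y : Stable n} → lo x ≡ k ⊎ hi x ≡ k → lo y ≡ k ⊎ hi y ≡ k → ¬ Disjoint x y
  meet (inj₁ refl) (inj₁ eq) (d , _)         = d (sym eq)
  meet (inj₁ refl) (inj₂ eq) (_ , d , _)     = d (sym eq)
  meet (inj₂ refl) (inj₁ eq) (_ , _ , d , _) = d (sym eq)
  meet (inj₂ refl) (inj₂ eq) (_ , _ , _ , d) = d (sym eq)

  mono-edge : ∀ {k x y} → OrderedAdj x y → Colour k x → Colour k y → x ≡ u × y ≡ v
  mono-edge {x = x} {y} (_ , disj , _) (inj₁ (_ , p)) (inj₁ (_ , q)) = ⊥-elim (meet {x = x} {y} p q disj)
  mono-edge _ (inj₁ (¬k , _)) (inj₂ cl) = contradiction (class-core cl) ¬k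
  mono-edge _ (inj₂ cl) (inj₁ (¬k , _)) = contradiction (class-core cl) ¬k
  mono-edge adj (inj₂ cl) (inj₂ cl′) =
    let ((p , q) , (p′ , q′)) = only-edge cl cl′ adj in stable-ext p q , stable-ext p′ q′

  proper : ∀ {k x y} → x ~ y → Colour k x → Colour k y → ⊥
  proper (inj₁ adj , kept) p q = kept (inj₁ (mono-edge adj p q))
  proper (inj₂ adj , kept) p q with mono-edge adj q p
  ... | y≡u , x≡v = kept (inj₂ (x≡v , y≡u))

-- Crossing edges ac, bd with a = 1 or c = b + 1: all pairs inside {a,b,c,d} form one class.
module Quadruple {n} {a b c d : ℕ} (1≤a : 1 ≤ a) (a<b : a < b) (b<c : b < c) (c<d : c < d) (d≤n : d ≤ n)
                 (short : a ≤ 1 ⊎ c ≤ suc b) where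

  Core : ℕ → Set
  Core k = k ≡ a ⊎ k ≡ b ⊎ k ≡ c ⊎ k ≡ d

  core? : ∀ k → Dec (Core k)
  core? k = k ≟ a ⊎-dec k ≟ b ⊎-dec k ≟ c ⊎-dec k ≟ d

  a≤core : ∀ {k} → Core k → a ≤ k
  a≤core (inj₁ refl)               = ≤-refl
  a≤core (inj₂ (inj₁ refl))        = <⇒≤ a<b
  a≤core (inj₂ (inj₂ (inj₁ refl))) = <⇒≤ (<-trans a<b b<c)
  a≤core (inj₂ (inj₂ (inj₂ refl))) = <⇒≤ (<-trans a<b (<-trans b<c c<d))

  core≤d : ∀ {k} → Core k → k ≤ d
  core≤d (inj₁ refl)               = <⇒≤ (<-trans a<b (<-trans b<c c<d))
  core≤d (inj₂ (inj₁ refl))        = <⇒≤ (<-trans b<c c<d)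
  core≤d (inj₂ (inj₂ (inj₁ refl))) = <⇒≤ c<d
  core≤d (inj₂ (inj₂ (inj₂ refl))) = ≤-refl

  Consecutive : ℕ → ℕ → Set
  Consecutive x y = ∀ {k} → Core k → x < k → y ≤ k

  a⋖b : Consecutive a b
  a⋖b (inj₁ refl)               a<a = contradiction a<a (<-irrefl refl)
  a⋖b (inj₂ (inj₁ refl))        _   = ≤-refl
  a⋖b (inj₂ (inj₂ (inj₁ refl))) _   = <⇒≤ b<c
  a⋖b (inj₂ (inj₂ (inj₂ refl))) _   = <⇒≤ (<-trans b<c c<d)

  b⋖c : Consecutive b c
  b⋖c (inj₁ refl)               b<a = contradiction b<a (<-asym a<b)
  b⋖c (inj₂ (inj₁ refl))        b<b = contradiction b<b (<-irrefl refl)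
  b⋖c (inj₂ (inj₂ (inj₁ refl))) _   = ≤-refl
  b⋖c (inj₂ (inj₂ (inj₂ refl))) _   = <⇒≤ c<d

  c⋖d : Consecutive c d
  c⋖d (inj₁ refl)               c<a = contradiction c<a (<-asym (<-trans a<b b<c))
  c⋖d (inj₂ (inj₁ refl))        c<b = contradiction c<b (<-asym b<c)
  c⋖d (inj₂ (inj₂ (inj₁ refl))) c<c = contradiction c<c (<-irrefl refl)
  c⋖d (inj₂ (inj₂ (inj₂ refl))) _   = ≤-refl

  below : ∀ {x y k l} → Consecutive x y → Core k → k < l → l ≤ y → k ≤ x
  below x⋖y p k<l l≤y = ≮⇒≥ λ x<k → <⇒≱ (<-≤-trans k<l l≤y) (x⋖y p x<k)

  -- A chain of four core points exhausts the core: lower bounds propagate upwards from a, upper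
  -- bounds downwards from d.
  increasing : ∀ {w x y z} → Core w → Core x → Core y → Core z → w < x → x < y → y < z →
    w ≡ a × x ≡ b × y ≡ c × z ≡ d
  increasing {w} {x} {y} {z} pw px py pz w<x x<y y<z =
    ≤-antisym w≤a a≤w , ≤-antisym x≤b b≤x , ≤-antisym y≤c c≤y , ≤-antisym (core≤d pz) d≤z
    where
    a≤w = a≤core pw
    b≤x = a⋖b px (≤-<-trans a≤w w<x)
    c≤y = b⋖c py (≤-<-trans b≤x x<y)
    d≤z = c⋖d pz (≤-<-trans c≤y y<z)
    y≤c = below c⋖d py y<z (core≤d pz)
    x≤b = below b⋖c px x<y y≤c
    w≤a = below a⋖b pw w<x x≤b

  Class : ℕ → Stable n → Set
  Class k w = k ≡ a × Core (lo w) × Core (hi w)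

  -- Disjoint pairs use all four points, so besides ac-bd only ad-bc could be an edge. It is not
  -- transverse if a = 1, and bc is not stable if c = b + 1.
  only-edge : ∀ {k x y} → Class k x → Class k y → OrderedAdj x y →
    (lo x ≡ a × hi x ≡ c) × (lo y ≡ b × hi y ≡ d)
  only-edge (_ , lx , hx) (_ , ly , hy) (_ , _ , inj₁ (p , q , r)) =
    let (α , β , γ , δ) = increasing lx ly hx hy p q r in (α , γ) , (β , δ)
  only-edge {y = y} (_ , lx , hx) (_ , ly , hy) (_ , _ , inj₂ (1<l , p , q , r)) =
    let (α , β , γ , _) = increasing lx ly hy hx p q r in contradiction short λ where
      (inj₁ a≤1)   → <⇒≱ 1<l (subst (_≤ 1) (sym α) a≤1)
      (inj₂ c≤1+b) → <⇒≱ (2+lo≤hi y) (subst₂ (λ h l → h ≤ suc l) (sym γ) (sym β) c≤1+b)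

  coreColouring : ∀ {u v : Stable n} → lo u ≡ a → hi u ≡ c → lo v ≡ b → hi v ≡ d → CoreColouring u v
  coreColouring refl refl refl refl = record
    { Core        = Core
    ; core?       = core?
    ; core-bounds = λ p → ≤-trans 1≤a (a≤core p) , ≤-trans (core≤d p) d≤n
    ; Class       = Class
    ; classify    = λ w p q → a , refl , p , q
    ; class-core  = λ (k≡a , _) → inj₁ k≡a
    ; core-p      = inj₂ (inj₁ refl)
    ; core-q      = inj₂ (inj₂ (inj₁ refl))
    ; core-r      = inj₂ (inj₂ (inj₂ refl))
    ; p<q         = b<c
    ; q<r         = c<d
    ; unused      = λ { (refl , _) → <⇒≢ a<b , <⇒≢ (<-trans a<b b<c) , <⇒≢ (<-trans a<b (<-trans b<c c<d)) }
    ; only-edge   = λ {k} {x} {y} → only-edge {k} {x} {y}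
    }

-- For the remaining edges 1 < a < b and b + 2 ≤ c; we write c = 2 + e.
module Interval {n} {a b e d : ℕ} (1<a : 1 < a) (a<b : a < b) (b≤e : b ≤ e) (c<d : 2 + e < d) (d≤n : d ≤ n) where

  c : ℕ
  c = 2 + e

  Core : ℕ → Set
  Core k = k ≡ 1 ⊎ k ≡ a ⊎ (b ≤ k × k ≤ c) ⊎ k ≡ d

  core? : ∀ k → Dec (Core k)
  core? k = k ≟ 1 ⊎-dec k ≟ a ⊎-dec (b ≤? k ×-dec k ≤? c) ⊎-dec k ≟ d

  1<b : 1 < b
  1<b = <-trans 1<a a<b

  a≤e : a ≤ e
  a≤e = <⇒≤ (<-≤-trans a<b b≤e)

  e<c : e < c
  e<c = m≤n⇒m≤1+n ≤-refl

  e<d : e < d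
  e<d = <-trans e<c c<d

  1+e<d : suc e < d
  1+e<d = <-trans ≤-refl c<d

  core-bounds : ∀ {k} → Core k → 1 ≤ k × k ≤ n
  core-bounds (inj₁ refl) = ≤-refl , ≤-trans (<⇒≤ (<-≤-trans 1<a a≤e)) (≤-trans (<⇒≤ e<d) d≤n)
  core-bounds (inj₂ (inj₁ refl)) = <⇒≤ 1<a , ≤-trans a≤e (≤-trans (<⇒≤ e<d) d≤n)
  core-bounds (inj₂ (inj₂ (inj₁ (b≤k , k≤c)))) = ≤-trans (<⇒≤ 1<b) b≤k , ≤-trans k≤c (≤-trans (<⇒≤ c<d) d≤n)
  core-bounds (inj₂ (inj₂ (inj₂ refl))) = <⇒≤ (≤-<-trans (<⇒≤ (<-≤-trans 1<a a≤e)) e<d) , d≤n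

  core-upper : ∀ {k} → Core k → k ≤ suc e ⊎ k ≡ c ⊎ k ≡ d
  core-upper (inj₁ refl) = inj₁ (s≤s z≤n)
  core-upper (inj₂ (inj₁ refl)) = inj₁ (m≤n⇒m≤1+n a≤e)
  core-upper (inj₂ (inj₂ (inj₁ (_ , k≤c)))) with m≤n⇒m<n∨m≡n k≤c
  ... | inj₁ k<c = inj₁ (s≤s⁻¹ k<c)
  ... | inj₂ k≡c = inj₂ (inj₁ k≡c)
  core-upper (inj₂ (inj₂ (inj₂ k≡d))) = inj₂ (inj₂ k≡d)

  data Lower (w : Stable n) : Set where
    at-1  : lo w ≡ 1 → Lower w
    at-a  : lo w ≡ a → Lower w
    at-b  : lo w ≡ b → Lower w
    mid   : b < lo w → lo w ≤ e → Lower w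
    above : e < lo w → hi w ≡ d → Lower w

  -- A pair starting beyond c - 2 ends beyond c, where d is the only core point.
  lower : ∀ w → Core (lo w) → Core (hi w) → Lower w
  lower w (inj₁ eq) _ = at-1 eq
  lower w (inj₂ (inj₁ eq)) _ = at-a eq
  lower w (inj₂ (inj₂ p)) q with b ≟ lo w | lo w ≤? e
  ... | yes eq | _      = at-b (sym eq)
  ... | no b≢  | yes ≤e = mid (≤∧≢⇒< (b≤lo p) b≢) ≤e
    where
    b≤lo : (b ≤ lo w × lo w ≤ c) ⊎ lo w ≡ d → b ≤ lo w
    b≤lo (inj₁ (b≤ , _)) = b≤
    b≤lo (inj₂ eq) = ≤-trans b≤e (≤-trans (<⇒≤ e<d) (≤-reflexive (sym eq)))
  ... | no _ | no ≰e = above (≰⇒> ≰e) (hi≡d (core-upper q))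
    where
    c<hi : c < hi w
    c<hi = ≤-trans (s≤s (s≤s (≰⇒> ≰e))) (2+lo≤hi w)
    hi≡d : hi w ≤ suc e ⊎ hi w ≡ c ⊎ hi w ≡ d → hi w ≡ d
    hi≡d (inj₁ ≤1+e) = contradiction ≤1+e (<⇒≱ (<-trans ≤-refl c<hi))
    hi≡d (inj₂ (inj₁ eq)) = contradiction eq (>⇒≢ c<hi)
    hi≡d (inj₂ (inj₂ eq)) = eq

  b≤k≤e⇒core : ∀ {k} → b ≤ k → k ≤ e → Core k
  b≤k≤e⇒core b≤k k≤e = inj₂ (inj₂ (inj₁ (b≤k , ≤-trans k≤e (<⇒≤ e<c))))

  core-c : Core c
  core-c = inj₂ (inj₂ (inj₁ (≤-trans b≤e (<⇒≤ e<c) , ≤-refl)))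

  core-1+e : Core (suc e)
  core-1+e = inj₂ (inj₂ (inj₁ (m≤n⇒m≤1+n b≤e , n≤1+n _)))

  -- The excluded values are the three core points that label no class.
  Unused : ℕ → Set
  Unused k = k ≢ 1 × k ≢ suc e × k ≢ d

  unused-≤e : ∀ {k} → 1 < k → k ≤ e → Unused k
  unused-≤e 1<k k≤e = >⇒≢ 1<k , <⇒≢ (s≤s k≤e) , <⇒≢ (≤-<-trans k≤e e<d)

  unused-c : Unused c
  unused-c = (λ ()) , >⇒≢ ≤-refl , <⇒≢ c<d

  -- Crossing and transverse edges share the core and the labels a, c and b, ..., c - 2; only the
  -- classes differ.
  assemble : ∀ {u v : Stable n} (Class : ℕ → Stable n → Set) →
    (∀ w → Core (lo w) → Core (hi w) → ∃[ k ] Class k w) →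
    (∀ {k w} → Class k w → k ≡ a ⊎ k ≡ c ⊎ (b ≤ k × k ≤ e)) →
    (∀ {k x y} → Class k x → Class k y → OrderedAdj x y →
      (lo x ≡ lo u × hi x ≡ hi u) × (lo y ≡ lo v × hi y ≡ hi v)) →
    CoreColouring u v
  assemble Class classify label only-edge = record
    { Core        = Core
    ; core?       = core?
    ; core-bounds = core-bounds
    ; Class       = Class
    ; classify    = classify
    ; class-core  = label-core ∘ label
    ; core-p      = inj₁ refl
    ; core-q      = core-1+e
    ; core-r      = inj₂ (inj₂ (inj₂ refl))
    ; p<q         = s≤s (<⇒≤ (<-≤-trans 1<a a≤e))
    ; q<r         = 1+e<d
    ; unused      = label-unused ∘ label
    ; only-edge   = only-edge
    }
    where
    label-core : ∀ {k} → k ≡ a ⊎ k ≡ c ⊎ (b ≤ k × k ≤ e) → Core k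
    label-core (inj₁ eq) = inj₂ (inj₁ eq)
    label-core (inj₂ (inj₁ refl)) = core-c
    label-core (inj₂ (inj₂ (b≤k , k≤e))) = b≤k≤e⇒core b≤k k≤e
    label-unused : ∀ {k} → k ≡ a ⊎ k ≡ c ⊎ (b ≤ k × k ≤ e) → Unused k
    label-unused (inj₁ refl) = unused-≤e 1<a a≤e
    label-unused (inj₂ (inj₁ refl)) = unused-c
    label-unused (inj₂ (inj₂ (b≤k , k≤e))) = unused-≤e (<-≤-trans 1<b b≤k) k≤e

  a≢c : a ≢ c
  a≢c = <⇒≢ (≤-<-trans a≤e e<c)

  -- Crossing edges ac-bd with 1 < a and b + 2 ≤ c

  data Crossed (k : ℕ) (w : Stable n) : Set where
    -- Pairs hd with h ≥ c - 1 fit here: they meet ad in d, and every other ah' in this class ends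
    -- by c - 1.
    class-a : k ≡ a → (lo w ≡ a × (hi w ≤ suc e ⊎ hi w ≡ d)) ⊎ (e < lo w × hi w ≡ d) → Crossed k w
    -- The third pair bc shares a point with each end of the deleted edge.
    class-c : k ≡ c → (lo w ≡ a × hi w ≡ c) ⊎ (lo w ≡ b × (hi w ≡ c ⊎ hi w ≡ d)) → Crossed k w
    -- {k h} together with 1 h for h ≥ c - 1 (if k = b) or h ≤ c - 2 (if k = c - 2)
    class-k : b ≤ k → k ≤ e → (lo w ≡ k × (k ≡ b → hi w ≤ suc e)) ⊎ (lo w ≡ 1 × (hi w ≤ k ⊎ (k ≡ b × e < hi w))) → Crossed k w

  crossed-classify : ∀ w → Core (lo w) → Core (hi w) → ∃[ k ] Crossed k w
  crossed-classify w p q with lower w p q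
  ... | at-1 l with hi w ≤? e
  ...   | yes h≤e = e , class-k b≤e ≤-refl (inj₂ (l , inj₁ h≤e))
  ...   | no h≰e = b , class-k ≤-refl b≤e (inj₂ (l , inj₂ (refl , ≰⇒> h≰e)))
  crossed-classify w p q | at-a l with core-upper q
  ...   | inj₁ h = a , class-a refl (inj₁ (l , inj₁ h))
  ...   | inj₂ (inj₁ h) = c , class-c refl (inj₁ (l , h))
  ...   | inj₂ (inj₂ h) = a , class-a refl (inj₁ (l , inj₂ h))
  crossed-classify w p q | at-b l with core-upper q
  ...   | inj₁ h = b , class-k ≤-refl b≤e (inj₁ (l , λ _ → h))
  ...   | inj₂ h = c , class-c refl (inj₂ (l , h))
  crossed-classify w p q | mid b<l l≤e = lo w , class-k (<⇒≤ b<l) l≤e (inj₁ (refl , λ l≡b → contradiction l≡b (>⇒≢ b<l)))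
  crossed-classify w p q | above e<l h = a , class-a refl (inj₂ (e<l , h))

  crossed-label : ∀ {k w} → Crossed k w → k ≡ a ⊎ k ≡ c ⊎ (b ≤ k × k ≤ e)
  crossed-label (class-a k≡a _) = inj₁ k≡a
  crossed-label (class-c k≡c _) = inj₂ (inj₁ k≡c)
  crossed-label (class-k b≤k k≤e _) = inj₂ (inj₂ (b≤k , k≤e))

  -- Labels from different constructors differ because a < b ≤ k < c. A pair starting at 1 is never
  -- the outer one of a transverse pair; it does not cross kh either, since it ends by k or no
  -- earlier than h.
  crossed-only : ∀ {k x y} → Crossed k x → Crossed k y → OrderedAdj x y →
    (lo x ≡ a × hi x ≡ c) × (lo y ≡ b × hi y ≡ d)
  crossed-only (class-a k≡a _) (class-c k≡c _) _ = contradiction (trans (sym k≡a) k≡c) a≢c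
  crossed-only (class-c k≡c _) (class-a k≡a _) _ = contradiction (trans (sym k≡a) k≡c) a≢c
  crossed-only (class-a refl _) (class-k b≤a _ _) _ = contradiction b≤a (<⇒≱ a<b)
  crossed-only (class-k b≤a _ _) (class-a refl _) _ = contradiction b≤a (<⇒≱ a<b)
  crossed-only (class-c refl _) (class-k _ c≤e _) _ = contradiction c≤e (<⇒≱ e<c)
  crossed-only (class-k _ c≤e _) (class-c refl _) _ = contradiction c≤e (<⇒≱ e<c)
  crossed-only (class-a _ (inj₁ (refl , _))) (class-a _ (inj₁ (ly , _))) (l<l , _) = contradiction (sym ly) (<⇒≢ l<l)
  crossed-only (class-a _ (inj₂ (_ , refl))) (class-a _ (inj₂ (_ , hy))) (_ , (_ , _ , _ , h≢h) , _) = contradiction (sym hy) h≢h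
  crossed-only (class-a _ (inj₂ (e<l , _))) (class-a _ (inj₁ (refl , _))) (l<l , _) = contradiction (≤-trans a≤e (<⇒≤ e<l)) (<⇒≱ l<l)
  crossed-only (class-a _ (inj₁ (_ , inj₁ h≤))) (class-a _ (inj₂ (e<l , _))) (_ , _ , inj₁ (_ , l<h , _)) =
    contradiction (≤-trans h≤ e<l) (<⇒≱ l<h)
  crossed-only (class-a _ (inj₁ (_ , inj₂ refl))) (class-a _ (inj₂ (_ , hy))) (_ , (_ , _ , _ , h≢h) , _) = contradiction (sym hy) h≢h
  crossed-only (class-a _ (inj₁ (_ , inj₁ h≤))) (class-a _ (inj₂ (_ , refl))) (_ , _ , inj₂ (_ , _ , _ , h<h)) =
    contradiction (≤-trans h≤ (<⇒≤ 1+e<d)) (<⇒≱ h<h)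
  crossed-only (class-c _ (inj₁ (refl , _))) (class-c _ (inj₁ (ly , _))) (l<l , _) = contradiction (sym ly) (<⇒≢ l<l)
  crossed-only (class-c _ (inj₁ (_ , refl))) (class-c _ (inj₂ (_ , inj₁ hy))) (_ , (_ , _ , _ , h≢h) , _) = contradiction (sym hy) h≢h
  -- The one surviving case is the deleted edge itself.
  crossed-only (class-c _ (inj₁ x≡)) (class-c _ (inj₂ (ly , inj₂ hy))) _ = x≡ , (ly , hy)
  crossed-only (class-c _ (inj₂ (refl , _))) (class-c _ (inj₁ (refl , _))) (b<a , _) = contradiction b<a (<-asym a<b)
  crossed-only (class-c _ (inj₂ (refl , _))) (class-c _ (inj₂ (ly , _))) (l<l , _) = contradiction (sym ly) (<⇒≢ l<l)
  crossed-only (class-k _ _ (inj₁ (refl , _))) (class-k _ _ (inj₁ (ly , _))) (l<l , _) = contradiction (sym ly) (<⇒≢ l<l)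
  crossed-only {x = x} _ (class-k _ _ (inj₂ (refl , _))) (l<1 , _) = contradiction (1≤lo x) (<⇒≱ l<1)
  crossed-only (class-k _ _ (inj₂ (refl , _))) _ (_ , _ , inj₂ (1<1 , _)) = contradiction 1<1 (<-irrefl refl)
  crossed-only (class-k _ _ (inj₂ (_ , inj₁ h≤k))) (class-k _ _ (inj₁ (refl , _))) (_ , _ , inj₁ (_ , l<h , _)) =
    contradiction h≤k (<⇒≱ l<h)
  crossed-only (class-k _ _ (inj₂ (_ , inj₂ (k≡b , e<h)))) (class-k _ _ (inj₁ (_ , short))) (_ , _ , inj₁ (_ , _ , h<h)) =
    contradiction (≤-trans (short k≡b) e<h) (<⇒≱ h<h)

  crossing-coreColouring : ∀ {u v : Stable n} → lo u ≡ a → hi u ≡ c → lo v ≡ b → hi v ≡ d → CoreColouring u v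
  crossing-coreColouring refl refl refl refl =
    assemble Crossed crossed-classify crossed-label crossed-only

  -- Transverse edges ad-bc

  data Nested (k : ℕ) (w : Stable n) : Set where
    -- Now ac belongs here and crosses (c - 1)d, so the pairs hd with h ≥ c - 1 move to label b.
    -- Since 1c crosses (c - 1)d as well, the pairs 1h with h ≥ c move here.
    class-a : k ≡ a → (lo w ≡ a × hi w ≤ c) ⊎ (lo w ≡ 1 × c ≤ hi w) → Nested k w
    -- The third pair is bd, which meets both ad and bc.
    class-c : k ≡ c → (lo w ≡ a × hi w ≡ d) ⊎ (lo w ≡ b × (hi w ≡ c ⊎ hi w ≡ d)) → Nested k w
    -- {k h} together with 1 (c - 1) and h d for h ≥ c - 1 (if k = b) or 1 h for h ≤ c - 2 (if k = c - 2)
    class-k : b ≤ k → k ≤ e →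
      (lo w ≡ k × (k ≡ b → hi w ≤ suc e)) ⊎ (lo w ≡ 1 × (hi w ≤ k ⊎ (k ≡ b × hi w ≡ suc e))) ⊎ (k ≡ b × e < lo w × hi w ≡ d) →
      Nested k w

  nested-classify : ∀ w → Core (lo w) → Core (hi w) → ∃[ k ] Nested k w
  nested-classify w p q with lower w p q
  ... | at-1 l with <-cmp (hi w) (suc e)
  ...   | tri< h< _ _ = e , class-k b≤e ≤-refl (inj₂ (inj₁ (l , inj₁ (s≤s⁻¹ h<))))
  ...   | tri≈ _ h≡ _ = b , class-k ≤-refl b≤e (inj₂ (inj₁ (l , inj₂ (refl , h≡))))
  ...   | tri> _ _ h> = a , class-a refl (inj₂ (l , h>))
  nested-classify w p q | at-a l with core-upper q
  ...   | inj₁ h = a , class-a refl (inj₁ (l , m≤n⇒m≤1+n h))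
  ...   | inj₂ (inj₁ h) = a , class-a refl (inj₁ (l , ≤-reflexive h))
  ...   | inj₂ (inj₂ h) = c , class-c refl (inj₁ (l , h))
  nested-classify w p q | at-b l with core-upper q
  ...   | inj₁ h = b , class-k ≤-refl b≤e (inj₁ (l , λ _ → h))
  ...   | inj₂ h = c , class-c refl (inj₂ (l , h))
  nested-classify w p q | mid b<l l≤e = lo w , class-k (<⇒≤ b<l) l≤e (inj₁ (refl , λ l≡b → contradiction l≡b (>⇒≢ b<l)))
  nested-classify w p q | above e<l h = b , class-k ≤-refl b≤e (inj₂ (inj₂ (refl , e<l , h)))

  nested-label : ∀ {k w} → Nested k w → k ≡ a ⊎ k ≡ c ⊎ (b ≤ k × k ≤ e)
  nested-label (class-a k≡a _) = inj₁ k≡a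
  nested-label (class-c k≡c _) = inj₂ (inj₁ k≡c)
  nested-label (class-k b≤k k≤e _) = inj₂ (inj₂ (b≤k , k≤e))

  -- As for `crossed-only`; in addition, the pairs hd at label b start no earlier than those at
  -- label b starting at 1 or b end.
  nested-only : ∀ {k x y} → Nested k x → Nested k y → OrderedAdj x y →
    (lo x ≡ a × hi x ≡ d) × (lo y ≡ b × hi y ≡ c)
  nested-only (class-a k≡a _) (class-c k≡c _) _ = contradiction (trans (sym k≡a) k≡c) a≢c
  nested-only (class-c k≡c _) (class-a k≡a _) _ = contradiction (trans (sym k≡a) k≡c) a≢c
  nested-only (class-a refl _) (class-k b≤a _ _) _ = contradiction b≤a (<⇒≱ a<b)
  nested-only (class-k b≤a _ _) (class-a refl _) _ = contradiction b≤a (<⇒≱ a<b)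
  nested-only (class-c refl _) (class-k _ c≤e _) _ = contradiction c≤e (<⇒≱ e<c)
  nested-only (class-k _ c≤e _) (class-c refl _) _ = contradiction c≤e (<⇒≱ e<c)
  nested-only {x = x} _ (class-a _ (inj₂ (refl , _))) (l<1 , _) = contradiction (1≤lo x) (<⇒≱ l<1)
  nested-only (class-a _ (inj₁ (refl , _))) (class-a _ (inj₁ (ly , _))) (l<l , _) = contradiction (sym ly) (<⇒≢ l<l)
  nested-only (class-a _ (inj₂ (refl , _))) _ (_ , _ , inj₂ (1<1 , _)) = contradiction 1<1 (<-irrefl refl)
  nested-only (class-a _ (inj₂ (_ , c≤h))) (class-a _ (inj₁ (_ , h≤c))) (_ , _ , inj₁ (_ , _ , h<h)) =
    contradiction (≤-trans h≤c c≤h) (<⇒≱ h<h)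
  nested-only (class-c _ (inj₁ (refl , _))) (class-c _ (inj₁ (ly , _))) (l<l , _) = contradiction (sym ly) (<⇒≢ l<l)
  nested-only (class-c _ (inj₁ (_ , refl))) (class-c _ (inj₂ (_ , inj₂ hy))) (_ , (_ , _ , _ , h≢h) , _) = contradiction (sym hy) h≢h
  nested-only (class-c _ (inj₁ x≡)) (class-c _ (inj₂ (ly , inj₁ hy))) _ = x≡ , (ly , hy)
  nested-only (class-c _ (inj₂ (refl , _))) (class-c _ (inj₁ (refl , _))) (b<a , _) = contradiction b<a (<-asym a<b)
  nested-only (class-c _ (inj₂ (refl , _))) (class-c _ (inj₂ (ly , _))) (l<l , _) = contradiction (sym ly) (<⇒≢ l<l)
  nested-only {x = x} _ (class-k _ _ (inj₂ (inj₁ (refl , _)))) (l<1 , _) = contradiction (1≤lo x) (<⇒≱ l<1)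
  nested-only (class-k _ _ (inj₂ (inj₁ (refl , _)))) _ (_ , _ , inj₂ (1<1 , _)) = contradiction 1<1 (<-irrefl refl)
  nested-only (class-k _ _ (inj₁ (refl , _))) (class-k _ _ (inj₁ (ly , _))) (l<l , _) = contradiction (sym ly) (<⇒≢ l<l)
  nested-only (class-k _ _ (inj₂ (inj₁ (_ , inj₁ h≤k)))) (class-k _ _ (inj₁ (refl , _))) (_ , _ , inj₁ (_ , l<h , _)) =
    contradiction h≤k (<⇒≱ l<h)
  nested-only (class-k _ _ (inj₂ (inj₁ (_ , inj₂ (k≡b , h≡))))) (class-k _ _ (inj₁ (_ , short))) (_ , _ , inj₁ (_ , _ , h<h)) =
    contradiction (≤-trans (short k≡b) (≤-reflexive (sym h≡))) (<⇒≱ h<h)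
  nested-only (class-k _ k≤e (inj₂ (inj₁ (_ , inj₁ h≤k)))) (class-k _ _ (inj₂ (inj₂ (_ , e<l , _)))) (_ , _ , inj₁ (_ , l<h , _)) =
    contradiction (≤-trans h≤k (≤-trans k≤e (<⇒≤ e<l))) (<⇒≱ l<h)
  nested-only (class-k _ _ (inj₂ (inj₁ (_ , inj₂ (_ , h≡))))) (class-k _ _ (inj₂ (inj₂ (_ , e<l , _)))) (_ , _ , inj₁ (_ , l<h , _)) =
    contradiction (≤-trans (≤-reflexive h≡) e<l) (<⇒≱ l<h)
  nested-only (class-k _ _ (inj₁ (_ , short))) (class-k _ _ (inj₂ (inj₂ (k≡b , e<l , _)))) (_ , _ , inj₁ (_ , l<h , _)) =
    contradiction (≤-trans (short k≡b) e<l) (<⇒≱ l<h)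
  nested-only (class-k _ _ (inj₁ (_ , short))) (class-k _ _ (inj₂ (inj₂ (k≡b , _ , refl)))) (_ , _ , inj₂ (_ , _ , _ , h<h)) =
    contradiction (≤-trans (short k≡b) (<⇒≤ 1+e<d)) (<⇒≱ h<h)
  nested-only (class-k _ _ (inj₂ (inj₂ (_ , e<l , _)))) (class-k _ k≤e (inj₁ (refl , _))) (l<l , _) =
    contradiction (≤-trans k≤e (<⇒≤ e<l)) (<⇒≱ l<l)
  nested-only (class-k _ _ (inj₂ (inj₂ (_ , _ , refl)))) (class-k _ _ (inj₂ (inj₂ (_ , _ , hy)))) (_ , (_ , _ , _ , h≢h) , _) =
    contradiction (sym hy) h≢h

  transverse-coreColouring : ∀ {u v : Stable n} → lo u ≡ a → hi u ≡ d → lo v ≡ b → hi v ≡ c → CoreColouring u v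
  transverse-coreColouring refl refl refl refl =
    assemble Nested nested-classify nested-label nested-only

-- Criticality of every edge

coreColouring : ∀ {n} {u v : Stable n} → OrderedAdj u v → CoreColouring u v
coreColouring {u = u} {v} (_ , _ , inj₁ (a<b , b<c , c<d)) with lo u ≤? 1 | hi u ≤? suc (lo v)
... | yes a≤1 | _ = Quadruple.coreColouring (1≤lo u) a<b b<c c<d (hi≤n v) (inj₁ a≤1) refl refl refl refl
... | no _ | yes c≤1+b = Quadruple.coreColouring (1≤lo u) a<b b<c c<d (hi≤n v) (inj₂ c≤1+b) refl refl refl refl
... | no a≰1 | no c≰1+b = Interval.crossing-coreColouring (≰⇒> a≰1) a<b b≤e (subst (_< hi v) c≡ c<d) (hi≤n v) refl c≡ refl refl
  where
  b≤e : lo v ≤ hi u ∸ 2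
  b≤e = ∸-monoˡ-≤ 2 (≰⇒> c≰1+b)
  -- The truncated subtraction is exact because the gap forces `hi u` to be at least 2.
  c≡ : hi u ≡ 2 + (hi u ∸ 2)
  c≡ = sym (m+[n∸m]≡n (≤-trans (s≤s (s≤s z≤n)) (≰⇒> c≰1+b)))
-- A transverse edge has 1 < a, and stability of its inner pair gives b + 2 ≤ c, so `Interval`
-- always applies.
coreColouring {u = u} {v} (_ , _ , inj₂ (1<a , a<b , b<c , c<d)) =
  Interval.transverse-coreColouring 1<a a<b (∸-monoˡ-≤ 2 (2+lo≤hi v)) (subst (_< hi u) c≡ c<d) (hi≤n u) refl refl refl c≡
  where
  c≡ : hi v ≡ 2 + (hi v ∸ 2)
  c≡ = sym (m+[n∸m]≡n (≤-trans (s≤s (s≤s z≤n)) (2+lo≤hi v)))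

colourable-G-e : ∀ {m} (u v : Stable (3 + m)) → Graph._~_ (G (3 + m)) u v → Colourable (deleteEdge (G (3 + m)) u v) m
colourable-G-e u v (inj₁ adj) = colourable-deleteEdge (coreColouring adj)
colourable-G-e u v (inj₂ adj) with colourable-deleteEdge {u = v} {u} (coreColouring adj)
... | c , proper = c , λ (x~y , kept) → proper (x~y , kept ∘ swap)

-- A fresh colour for `u` alone repairs the edge, so a deletion lowers the chromatic number by at
-- most one.
colourable-restoreEdge : ∀ {n k} (u v : Stable n) → Colourable (deleteEdge (G n) u v) k → Colourable (G n) (suc k)
colourable-restoreEdge {n} {k} u v (c , proper) = (λ x → colour x (x ≟ˢ u)) , λ {x} {y} → proper′ x y (x ≟ˢ u) (y ≟ˢ u)
  where
  open Graph (G n) using (_~_; ~-irrefl)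
  colour : ∀ x → Dec (x ≡ u) → Fin (suc k)
  colour x (yes _) = fzero
  colour x (no _)  = fsuc (c x)
  proper′ : ∀ x y (p : Dec (x ≡ u)) (q : Dec (y ≡ u)) → x ~ y → colour x p ≢ colour y q
  proper′ x y (yes refl) (yes refl) x~y = ⊥-elim (~-irrefl {x} x~y)
  proper′ x y (yes _) (no _) _ ()
  proper′ x y (no _) (yes _) _ ()
  proper′ x y (no x≢u) (no y≢u) x~y eq = proper
    (x~y , λ { (inj₁ (x≡u , _)) → x≢u x≡u ; (inj₂ (_ , y≡u)) → y≢u y≡u }) (suc-injective eq)

theorem1 : (n : ℕ) → 4 ≤ n → (χ[ G n ]≡ (n ∸ 2)) × EdgeCritical (G n)
theorem1 (suc (suc (suc (suc m)))) (s≤s (s≤s (s≤s (s≤s z≤n)))) = χ-G , λ u v u~v →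
  suc m , 2 + m ,
  ( colourable-G-e u v u~v
  , λ k col → s≤s⁻¹ (χ-lower-bound m (suc k) (colourable-restoreEdge u v col))) ,
  χ-G , ≤-refl
  where
  χ-G : χ[ G (4 + m) ]≡ (2 + m)
  χ-G = colourable-by-lo (2 + m) , χ-lower-bound m
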